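{- Let $T$ be any string of length $n$ and let $\tau$ be any integer with $1 \le \tau \le n$. The number of (distinct) non-empty substrings $U$ of $T$ for which $|U|\cdot \tau < |\mathrm{Occ}_T(U)|$ is at most $n/\tau$.
   Context: Strings are finite and indexed from $1$. A substring of $T$ is a string of the form $T[i]T[i+1]\cdots T[j]$; substrings are counted as distinct strings. For a string $U$ of length $|U|$, $\mathrm{Occ}_T(U)$ is the set of starting positions $i \in \{1,\dots,n-|U|+1\}$ with $T[i]\cdots T[i+|U|-1] = U$. -}

module Defs where

open import Data.List.Base using (List; length; map; take; drop; upTo; filter; deduplicate; cartesianProductWith)
open import Data.List.Properties using (≡-dec)
open import Data.Nat.Base using (ℕ; suc; _+_; _*_; _∸_; _<_)
open import Data.Nat.Properties using (_<?_)
open import Data.Product.Base using (_×_)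
open import Relation.Binary.Definitions using (DecidableEquality)
open import Relation.Nullary.Decidable using (Dec; _×-dec_)

infix 8 _[_⋯_]

-- T [ i ⋯ j ] is the string T[i] T[i+1] ⋯ T[j]. Positions are counted from 1,
-- and the string is empty when j < i.
_[_⋯_] : ∀ {a} {A : Set a} → List A → ℕ → ℕ → List A
T [ i ⋯ j ] = take (suc j ∸ i) (drop (i ∸ 1) T)

-- The list 1, 2, …, m.
oneTo : ℕ → List ℕ
oneTo m = map suc (upTo m)

module _ {a} {A : Set a} (_≟_ : DecidableEquality A) where

  infix 4 _≟ˢ_
  _≟ˢ_ : DecidableEquality (List A)
  _≟ˢ_ = ≡-dec _≟_

  -- The candidate starting positions are 1, …, n - |U| + 1; truncated
  -- subtraction yields none at all when |U| > n.
  Occ : List A → List A → List ℕ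
  Occ T U = filter (λ i → T [ i ⋯ i + length U ∸ 1 ] ≟ˢ U)
                   (oneTo (suc (length T) ∸ length U))

  -- Every distinct T [ i ⋯ j ] with 1 ≤ i ≤ n + 1 and 0 ≤ j ≤ n, listed once.
  -- The pairs with j < i contribute only the empty substring.
  substrings : List A → List (List A)
  substrings T = deduplicate _≟ˢ_
    (cartesianProductWith (T [_⋯_]) (oneTo (suc (length T))) (upTo (suc (length T))))

  NonEmptyFrequent : List A → ℕ → List A → Set
  NonEmptyFrequent T τ U = 0 < length U × length U * τ < length (Occ T U)

  nonEmptyFrequent? : ∀ T τ U → Dec (NonEmptyFrequent T τ U)
  nonEmptyFrequent? T τ U =
    (0 <? length U) ×-dec (length U * τ <? length (Occ T U))

  #frequent : List A → ℕ → ℕ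
  #frequent T τ = length (filter (nonEmptyFrequent? T τ) (substrings T))

{-# OPTIONS --safe #-}
-- Let U be a longest string of a finite set F of frequent strings. At most |U|
-- members of F are prefixes of U, and U occurs at more than |U| τ positions.
-- By maximality, every other member of F is incomparable with U in the prefix
-- order, so it occurs at none of these positions. Deleting the prefixes of U
-- from F and the occurrences of U from the set of positions keeps all remaining
-- frequencies, and removes more than τ positions per deleted string. Iterating,
-- |F| τ ≤ n.
module Submission where

import Data.Integer.Base as ℤ
import Data.Integer.Properties as ℤ
open import Data.Integer.Base using (+_)
open import Data.List.Base using (List; []; _∷_; length; map; take; drop; upTo; filter; cartesianProductWith)
open import Data.List.Extrema.Nat using (argmax; argmax-sel; f[⊥]≤f[argmax]; f[xs]≤f[argmax])
open import Data.List.Membership.Propositional using (_∈_; lose)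
open import Data.List.Membership.Propositional.Properties
  using (∈-filter⁺; ∈-filter⁻; ∈-map⁺; ∈-map⁻; ∈-upTo⁺; ∈-upTo⁻)
open import Data.List.Properties
  using (filter-notAll; length-map; length-upTo; length-take; take-take; take-all)
open import Data.List.Relation.Binary.Subset.Propositional using (_⊆_)
open import Data.List.Relation.Unary.All using (All)
import Data.List.Relation.Unary.All as All
open import Data.List.Relation.Unary.All.Properties using (all-filter)
open import Data.List.Relation.Unary.AllPairs using ([]; _∷_)
open import Data.List.Relation.Unary.Any using (here; there)
open import Data.List.Relation.Unary.Unique.Propositional using (Unique)
open import Data.List.Relation.Unary.Unique.Propositional.Properties using (filter⁺; map⁺; upTo⁺)
open import Data.List.Relation.Unary.Unique.DecPropositional.Properties using (deduplicate-!)
open import Data.Nat.Base using (ℕ; suc; _+_; _*_; _∸_; _≤_; _<_; z≤n; NonZero)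
open import Data.Nat.Induction using (<-wellFounded)
import Data.Nat.Properties as ℕ
open import Data.Product.Base using (_×_; _,_; proj₁; proj₂; ∃-syntax)
open import Data.Rational.Base using (_/_) renaming (_≤_ to _≤ℚ_)
open import Data.Rational.Properties
  using (toℚᵘ-cancel-≤; toℚᵘ-fromℚᵘ)
import Data.Rational.Unnormalised.Base as ℚᵘ
import Data.Rational.Unnormalised.Properties as ℚᵘ
open import Data.Sum.Base using ([_,_]′)
open import Function.Base using (_∘_)
open import Induction.WellFounded using (Acc; acc)
open import Relation.Binary.Definitions using (DecidableEquality; Decidable)
open import Relation.Binary.PropositionalEquality
open import Relation.Nullary.Decidable using (yes; no; ¬?)
open import Relation.Nullary.Negation using (¬_)
import Relation.Unary as Unary
open import Defs

-- `_/_` normalises its fraction, so the comparison is moved to unnormalised rationals, where it is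
-- the cross-multiplied inequality `m * d ≤ n * 1`.
/1-≤-/ : ∀ m n d .{{_ : NonZero d}} → m * d ≤ n → (+ m / 1) ≤ℚ (+ n / d)
/1-≤-/ m n (suc d) md≤n = toℚᵘ-cancel-≤
  (ℚᵘ.≤-respʳ-≃ (ℚᵘ.≃-sym (toℚᵘ-fromℚᵘ (ℚᵘ.mkℚᵘ (+ n) d)))
    (ℚᵘ.≤-respˡ-≃ (ℚᵘ.≃-sym (toℚᵘ-fromℚᵘ (ℚᵘ.mkℚᵘ (+ m) 0)))
      (ℚᵘ.*≤* (subst₂ ℤ._≤_ (ℤ.pos-* m (suc d)) (sym (ℤ.*-identityʳ (+ n))) (ℤ.+≤+ md≤n)))))

module _ {b} {B : Set b} where

  ∃-maximal : ∀ (f : B → ℕ) x xs → ∃[ y ] y ∈ x ∷ xs × (∀ {z} → z ∈ x ∷ xs → f z ≤ f y)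
  ∃-maximal f x xs = argmax f x xs
    , [ here , there ]′ (argmax-sel f x xs)
    , λ { (here refl) → f[⊥]≤f[argmax] {f = f} x xs
        ; (there z∈xs) → All.lookup (f[xs]≤f[argmax] {f = f} x xs) z∈xs }

  length-filter+ : ∀ {p} {P : B → Set p} (P? : Unary.Decidable P) xs →
    length (filter P? xs) + length (filter (¬? ∘ P?) xs) ≡ length xs
  length-filter+ P? [] = refl
  length-filter+ P? (x ∷ xs) with P? x
  ... | yes _ = cong suc (length-filter+ P? xs)
  ... | no  _ = trans (ℕ.+-suc _ _) (cong suc (length-filter+ P? xs))

  module _ (_≟_ : DecidableEquality B) where

    -- Induction on `xs`: deleting every copy of the head from `ys` makes `ys` strictly shorter, yet
    -- loses no entry of the tail, as the head does not recur there.
    unique-⊆⇒length≤ : ∀ {xs ys : List B} → Unique xs → xs ⊆ ys → length xs ≤ length ys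
    unique-⊆⇒length≤ [] _ = z≤n
    unique-⊆⇒length≤ {x ∷ _} {ys} (x∉xs ∷ xs!) xs⊆ys = ℕ.≤-<-trans
      (unique-⊆⇒length≤ xs! (λ z∈xs →
        ∈-filter⁺ (¬? ∘ (x ≟_)) (xs⊆ys (there z∈xs)) (All.lookup x∉xs z∈xs)))
      (filter-notAll (¬? ∘ (x ≟_)) ys (lose (xs⊆ys (here refl)) (λ x≢x → x≢x refl)))

oneTo! : ∀ m → Unique (oneTo m)
oneTo! m = map⁺ ℕ.suc-injective (upTo⁺ m)

module _ {a} {A : Set a} where

  infix 4 _≼_
  -- The prefix order, written as the equation that `Occ` tests: an occurrence of a string at a
  -- position says that it is a prefix of the suffix starting there.
  _≼_ : List A → List A → Set a
  V ≼ U = take (length V) U ≡ V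

  ≼-refl : ∀ U → U ≼ U
  ≼-refl U = take-all (length U) U ℕ.≤-refl

  ≼⇒length≤ : ∀ {U V} → V ≼ U → length V ≤ length U
  ≼⇒length≤ {U} {V} V≼U = ℕ.m⊓n≡m⇒m≤n (trans (sym (length-take (length V) U)) (cong length V≼U))

  -- Two prefixes of `X` are cuts of the same string, so the shorter is a cut of the longer. This
  -- turns maximality of length into disjointness of occurrences.
  ≼-comparable : ∀ {U V X} → length V ≤ length U → U ≼ X → V ≼ X → V ≼ U
  ≼-comparable {U} {V} {X} V≤U U≼X V≼X = begin
    take (length V) U                   ≡⟨ cong (take (length V)) U≼X ⟨
    take (length V) (take (length U) X) ≡⟨ take-take (length V) (length U) X ⟩
    take _ X                            ≡⟨ cong (λ k → take k X) (ℕ.m≤n⇒m⊓n≡m V≤U) ⟩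
    take (length V) X                   ≡⟨ V≼X ⟩
    V ∎
    where open ≡-Reasoning

module _ {a} {A : Set a} (_≟_ : DecidableEquality A) where

  _≼?_ : Decidable (_≼_ {A = A})
  V ≼? U = _≟ˢ_ _≟_ (take (length V) U) V

  -- A prefix of `U` is determined by its length, which for a non-empty one is among 1, ..., |U|.
  length-prefixes≤ : ∀ U {F} → Unique F → All (λ V → 0 < length V) F →
    length (filter (_≼? U) F) ≤ length U
  length-prefixes≤ U {F} F! F>0 = subst (length (filter (_≼? U) F) ≤_)
    (trans (length-map prefix (upTo (length U))) (length-upTo (length U)))
    (unique-⊆⇒length≤ (_≟ˢ_ _≟_) (filter⁺ (_≼? U) F!) ⊆prefixes)
    where
    prefix : ℕ → List A
    prefix i = take (suc i) U

    ⊆prefixes : filter (_≼? U) F ⊆ map prefix (upTo (length U))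
    ⊆prefixes {V} V∈ with V∈F , V≼U ← ∈-filter⁻ (_≼? U) {xs = F} V∈
                     -- Non-emptiness exposes the length as a successor, so `V` is the prefix with
                     -- index `length vs`.
                     with V | All.lookup F>0 V∈F
    ... | v ∷ vs | _ = subst (_∈ map prefix (upTo (length U))) V≼U
                         (∈-map⁺ prefix (∈-upTo⁺ (≼⇒length≤ V≼U)))

  module _ (suffix : ℕ → List A) where

    occursAt? : ∀ U → Unary.Decidable (λ i → U ≼ suffix i)
    occursAt? U i = U ≼? suffix i

    occurrences : List A → List ℕ → List ℕ
    occurrences U = filter (occursAt? U)

    -- The position set is arbitrary because the induction, on the length of `F`, leaves gaps in it.
    -- Frequency is therefore measured inside `S`, and no property of the family `suffix` is used.
    frequent-bound : ∀ τ F S → Unique F → Unique S →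
      All (λ U → 0 < length U × length U * τ < length (occurrences U S)) F →
      length F * τ ≤ length S
    frequent-bound τ F₀ S₀ = go F₀ S₀ (<-wellFounded _)
      where
      go : ∀ F S → Acc _<_ (length F) → Unique F → Unique S →
        All (λ U → 0 < length U × length U * τ < length (occurrences U S)) F →
        length F * τ ≤ length S
      go [] S _ _ _ _ = z≤n
      go F@(U₀ ∷ F₁) S (acc rec) F! S! freq
        with U , U∈F , maximal ← ∃-maximal length U₀ F₁ = begin
          length F * τ                                        ≡⟨ cong (_* τ) (length-filter+ (_≼? U) F) ⟨
          (length (filter (_≼? U) F) + length F′) * τ         ≡⟨ ℕ.*-distribʳ-+ τ (length (filter (_≼? U) F)) (length F′) ⟩
          length (filter (_≼? U) F) * τ + length F′ * τ       ≤⟨ ℕ.+-mono-≤ prefixes≤ rest≤ ⟩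
          length (occurrences U S) + length S′                ≡⟨ length-filter+ (occursAt? U) S ⟩
          length S                                            ∎
        where
        open ℕ.≤-Reasoning
        keep? : Unary.Decidable (λ V → ¬ V ≼ U)
        keep? = ¬? ∘ (_≼? U)
        F′ : List (List A)
        F′ = filter keep? F
        free? : Unary.Decidable (λ i → ¬ U ≼ suffix i)
        free? = ¬? ∘ occursAt? U
        S′ : List ℕ
        S′ = filter free? S

        prefixes≤ : length (filter (_≼? U) F) * τ ≤ length (occurrences U S)
        -- The deleted strings are paid for by the occurrences of `U` alone: at most |U| strings, at
        -- cost `τ` each.
        prefixes≤ = ℕ.≤-trans
          (ℕ.*-monoˡ-≤ τ (length-prefixes≤ U F! (All.map proj₁ freq)))
          (ℕ.<⇒≤ (proj₂ (All.lookup freq U∈F)))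

        occurrences-kept : ∀ {V} → V ∈ F → ¬ V ≼ U → occurrences V S ⊆ occurrences V S′
        occurrences-kept {V} V∈F V⋠U i∈
          with i∈S , V≼i ← ∈-filter⁻ (occursAt? V) {xs = S} i∈
          -- Were `U` also to occur at this position, `V`, being no longer than `U`, would be a
          -- prefix of `U`.
          = ∈-filter⁺ (occursAt? V) (∈-filter⁺ free? i∈S (λ U≼i → V⋠U (≼-comparable (maximal V∈F) U≼i V≼i))) V≼i

        freq′ : ∀ {V} → V ∈ F′ → 0 < length V × length V * τ < length (occurrences V S′)
        freq′ {V} V∈F′ with V∈F , V⋠U ← ∈-filter⁻ keep? {xs = F} V∈F′
                   with V>0 , V-frequent ← All.lookup freq V∈F
          = V>0 , ℕ.<-≤-trans V-frequent
                    (unique-⊆⇒length≤ ℕ._≟_ (filter⁺ (occursAt? V) S!) (occurrences-kept V∈F V⋠U))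

        rest≤ : length F′ * τ ≤ length S′
        rest≤ = go F′ S′
          -- `U` is a prefix of itself, so at least one string is deleted and the recursion
          -- descends.
          (rec (filter-notAll keep? F (lose U∈F (λ U⋠U → U⋠U (≼-refl U)))))
          (filter⁺ keep? F!) (filter⁺ free? S!) (All.tabulate freq′)

  -- The last candidate start is n - |U| + 1, which is at most n once `U` is non-empty; the empty
  -- string would also occur at n + 1.
  length-Occ≤ : ∀ T U → 0 < length U →
    length (Occ _≟_ T U) ≤ length (occurrences (λ i → drop (i ∸ 1) T) U (oneTo (length T)))
  length-Occ≤ T U U>0 = unique-⊆⇒length≤ ℕ._≟_ (filter⁺ occ? (oneTo! m)) Occ⊆
    where
    m : ℕ
    m = suc (length T) ∸ length U
    occ? : Unary.Decidable (λ i → T [ i ⋯ i + length U ∸ 1 ] ≡ U)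
    occ? i = _≟ˢ_ _≟_ (T [ i ⋯ i + length U ∸ 1 ]) U

    Occ⊆ : Occ _≟_ T U ⊆ occurrences (λ i → drop (i ∸ 1) T) U (oneTo (length T))
    Occ⊆ i∈Occ
      with i∈ , T[i⋯]≡U ← ∈-filter⁻ occ? {xs = oneTo m} i∈Occ
      -- With the start written as `suc k`, the truncated subtractions compute: the slice drops `k`
      -- letters and takes `k + length U ∸ k`.
      with k , k∈ , refl ← ∈-map⁻ suc i∈
      = ∈-filter⁺ (occursAt? (λ i → drop (i ∸ 1) T) U)
          (∈-map⁺ suc (∈-upTo⁺ (ℕ.<-≤-trans (∈-upTo⁻ k∈) (ℕ.∸-monoʳ-≤ (suc (length T)) U>0))))
          (subst (λ l → take l (drop k T) ≡ U) (ℕ.m+n∸m≡n k (length U)) T[i⋯]≡U)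

  -- The counting bound is applied to the actual suffixes of `T`, with all of 1, ..., n as the
  -- initial budget of positions.
  #frequent*τ≤length : ∀ T τ → #frequent _≟_ T τ * τ ≤ length T
  #frequent*τ≤length T τ = subst (#frequent _≟_ T τ * τ ≤_)
    (trans (length-map suc (upTo (length T))) (length-upTo (length T)))
    (frequent-bound (λ i → drop (i ∸ 1) T) τ
      (filter (nonEmptyFrequent? _≟_ T τ) (substrings _≟_ T)) (oneTo (length T))
      (filter⁺ (nonEmptyFrequent? _≟_ T τ) (deduplicate-! (_≟ˢ_ _≟_)
        (cartesianProductWith (T [_⋯_]) (oneTo (suc (length T))) (upTo (suc (length T))))))
      (oneTo! (length T))
      (All.map (λ {U} (U>0 , U-frequent) → U>0 , ℕ.<-≤-trans U-frequent (length-Occ≤ T U U>0))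
        (all-filter (nonEmptyFrequent? _≟_ T τ) (substrings _≟_ T))))

corollary1p3 : ∀ {a} {A : Set a} (_≟_ : DecidableEquality A) (n : ℕ) (T : List A) → length T ≡ n →
    (τ : ℕ) .{{_ : NonZero τ}} → τ ≤ n →
    (+ (#frequent _≟_ T τ) / 1) ≤ℚ (+ n / τ)
corollary1p3 _≟_ n T refl τ _ = /1-≤-/ (#frequent _≟_ T τ) n τ (#frequent*τ≤length _≟_ T τ)
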